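{- For all $L,h\in\mathbb{N}$ satisfying $0\le h\le L/2$, $$s(L,h)=s(L-h-1,h)+s(L-h,h)-s(L-2h-1,h)+s(h-1,L-2)+s(h-1,L-1).$$
   Context: $\mathbb{N}=\{0,1,2,\dots\}$. For a finite word $w$ over $\{0,1\}$, $|w|$ is its length and $|w|_0,|w|_1$ are its numbers of $0$'s and $1$'s; $|w|_1$ is the height of $w$. A subword means a contiguous factor. A word $w$ is balanced if for all finite subwords $u,v$ of $w$ with $|u|=|v|$ one has $\bigl||u|_0-|v|_0\bigr|\le 1$. For $0\le h\le L$, $\mathbb{S}(L,h)$ is the set of balanced words in $\{0,1\}^*$ of length $L$ and height $h$. The function $s:\mathbb{Z}^2\to\mathbb{N}$ is defined by $s(L,h)=\#\mathbb{S}(L,h\bmod L)$ if $L>0$ (with $h\bmod L\in\{0,\dots,L-1\}$), $s(0,0)=1$, and $s(L,h)=0$ if $L<0$ or if $L=0$ and $h\ne0$. -}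

module Defs where

open import Data.Nat as ℕ using (ℕ; zero; suc; _≤_; ∣_-_∣)
import Data.Nat.Properties as ℕ
open import Data.Integer.Base using (ℤ; +_; -[1+_])
open import Data.Integer.DivMod using (_%ℕ_)
open import Data.Fin.Base using (Fin)
open import Data.Fin.Patterns using (0F; 1F)
import Data.Fin.Properties as Fin
open import Data.List.Base
  using (List; []; _∷_; length; filter; concatMap; inits; tails; allFin; cartesianProductWith)
open import Data.List.Properties using (∷-injective)
open import Data.List.Membership.Propositional using (_∈_; find; lose)
open import Data.List.Membership.Propositional.Properties
  using (∈-map⁺; ∈-map⁻; ∈-concatMap⁺; ∈-concatMap⁻; ∈-filter⁺; ∈-filter⁻; ∈-allFin;
         ∈-cartesianProductWith⁺; ∈-cartesianProductWith⁻)
open import Data.List.Relation.Unary.Any using (Any; here; there)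
open import Data.List.Relation.Unary.All using (all?; lookup; tabulate)
import Data.List.Relation.Unary.AllPairs as AllPairs
import Data.List.Relation.Unary.All as All
open import Data.List.Relation.Unary.Unique.Propositional using (Unique)
import Data.List.Relation.Unary.Unique.Propositional.Properties as Unique
open import Data.List.Relation.Binary.Infix.Heterogeneous using (Infix; here; there)
open import Data.List.Relation.Binary.Prefix.Heterogeneous using (Prefix; []; _∷_)
open import Data.Product.Base using (_×_; _,_)
open import Relation.Binary.PropositionalEquality using (_≡_; refl; cong)
open import Relation.Nullary.Decidable using (map′; _×-dec_; _→-dec_)
open import Relation.Unary using (Decidable)

Word : Set
Word = List (Fin 2)

∣_∣[_] : Word → Fin 2 → ℕ
∣ w ∣[ a ] = length (filter (Fin._≟ a) w)

height : Word → ℕ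
height w = ∣ w ∣[ 1F ]

Subword : Word → Word → Set
Subword = Infix _≡_

Balanced : Word → Set
Balanced w = ∀ u v → Subword u w → Subword v w → length u ≡ length v →
             ∣ ∣ u ∣[ 0F ] - ∣ v ∣[ 0F ] ∣ ≤ 1

subwords : Word → List Word
subwords w = concatMap inits (tails w)

prefix⇒∈inits : ∀ {u w : Word} → Prefix _≡_ u w → u ∈ inits w
prefix⇒∈inits []         = here refl
prefix⇒∈inits (refl ∷ p) = there (∈-map⁺ (_ ∷_) (prefix⇒∈inits p))

∈inits⇒prefix : ∀ {u : Word} w → u ∈ inits w → Prefix _≡_ u w
∈inits⇒prefix w       (here refl) = []
∈inits⇒prefix (x ∷ w) (there u∈)  with ∈-map⁻ (x ∷_) u∈
... | _ , v∈ , refl = refl ∷ ∈inits⇒prefix w v∈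

subword⇒∈subwords : ∀ {u w} → Subword u w → u ∈ subwords w
subword⇒∈subwords p = ∈-concatMap⁺ inits (go p)
  where
  go : ∀ {u w} → Subword u w → Any (λ t → u ∈ inits t) (tails w)
  go (here p)  = here (prefix⇒∈inits p)
  go (there p) = there (go p)

∈subwords⇒subword : ∀ {u} w → u ∈ subwords w → Subword u w
∈subwords⇒subword w u∈ = go w (∈-concatMap⁻ inits u∈)
  where
  go : ∀ {u} w → Any (λ t → u ∈ inits t) (tails w) → Subword u w
  go w       (here p)  = here (∈inits⇒prefix w p)
  go (x ∷ w) (there p) = there (go w p)

balanced? : Decidable Balanced
balanced? w = map′
  (λ all _ _ p q → lookup (lookup all (subword⇒∈subwords p)) (subword⇒∈subwords q))
  (λ bal → tabulate λ u∈ → tabulate λ v∈ →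
     bal _ _ (∈subwords⇒subword w u∈) (∈subwords⇒subword w v∈))
  (all? (λ u → all? (λ v →
     (length u ℕ.≟ length v) →-dec (∣ ∣ u ∣[ 0F ] - ∣ v ∣[ 0F ] ∣ ℕ.≤? 1))
     (subwords w)) (subwords w))

words : ℕ → List Word
words zero    = [] ∷ []
words (suc L) = cartesianProductWith _∷_ (allFin 2) (words L)

-- A duplicate-free list of the balanced words of length L and height h;
-- see ∈-𝕊⁺, ∈-𝕊⁻ and 𝕊-unique.
𝕊 : ℕ → ℕ → List Word
𝕊 L h = filter (λ w → balanced? w ×-dec (height w ℕ.≟ h)) (words L)

∈-words⁺ : ∀ w → w ∈ words (length w)
∈-words⁺ []      = here refl
∈-words⁺ (x ∷ w) = ∈-cartesianProductWith⁺ _∷_ (∈-allFin x) (∈-words⁺ w)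

∈-words⁻ : ∀ L {w} → w ∈ words L → length w ≡ L
∈-words⁻ zero    (here refl) = refl
∈-words⁻ (suc L) w∈ with ∈-cartesianProductWith⁻ _∷_ (allFin 2) (words L) w∈
... | _ , _ , _ , v∈ , refl = cong suc (∈-words⁻ L v∈)

words-unique : ∀ L → Unique (words L)
words-unique zero    = All.[] AllPairs.∷ AllPairs.[]
words-unique (suc L) =
  Unique.cartesianProductWith⁺ _∷_ ∷-injective (Unique.allFin⁺ 2) (words-unique L)

∈-𝕊⁺ : ∀ {L h w} → Balanced w → length w ≡ L → height w ≡ h → w ∈ 𝕊 L h
∈-𝕊⁺ {w = w} bal refl ht = ∈-filter⁺ _ (∈-words⁺ w) (bal , ht)

∈-𝕊⁻ : ∀ {L h w} → w ∈ 𝕊 L h → Balanced w × length w ≡ L × height w ≡ h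
∈-𝕊⁻ {L} {h} w∈ with ∈-filter⁻ (λ w → balanced? w ×-dec (height w ℕ.≟ h)) {xs = words L} w∈
... | w∈words , bal , ht = bal , ∈-words⁻ L w∈words , ht

𝕊-unique : ∀ L h → Unique (𝕊 L h)
𝕊-unique L h = Unique.filter⁺ _ (words-unique L)

s : ℤ → ℤ → ℕ
s (+ suc n) h     = length (𝕊 (suc n) (h %ℕ suc n))
s (+ zero)  (+ 0) = 1
s (+ zero)  _     = 0
s -[1+ _ ]  _     = 0

{-# OPTIONS --safe #-}

-- A word is determined by its gaps, the numbers of 0's before, between and after its
-- 1's, and it is balanced iff the sum of any m consecutive gaps exceeds the sum of any
-- m consecutive gaps lying between two 1's by at most 1.  This condition survives adding
-- 1 to every gap, and an outer gap 0 may be exempted from this.  With c_ab(L,h) the number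
-- of words in 𝕊(L,h) that start with a and end with b, growing the gaps gives, for 2h ≤ L,
--   c_01(L,h) = (c_01 + c_11)(L-h,h),  c_10(L,h) = (c_10 + c_11)(L-h,h),
--   c_11(L,h) = c_11(L-h+1,h),  and for 2h < L also c_00(L,h) = #𝕊(L-h-1,h).
-- Together with the complement symmetry c_00(L,h) = c_11(L,L-h), the recursion for c_11
-- is a Euclidean division which yields c_11(L,h) = s(h-1,L-1) and c_00(L,h) = s(L-h-1,h)
-- whenever h ≤ L (L ≥ 1, and h ≥ 1 for c_11); the theorem is the sum over the four
-- kinds of ends, once for (L,h) and once for (L-h,h).
module Submission where

open import Defs
open import Data.Nat as ℕ using (ℕ; zero; suc; _≤_; _<_; z≤n; s≤s; ∣_-_∣)
import Data.Nat.Properties as ℕ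
open import Data.Nat.DivMod using (_%_; m<n⇒m%n≡m; n%n≡0; [m+n]%n≡m%n)
open import Data.Nat.Induction using (<-rec)
open import Data.Nat.ListAction using (sum)
open import Data.Nat.ListAction.Properties using (sum-++)
import Data.Nat.Tactic.RingSolver as ℕ-Solver
open import Data.Integer using (+_; _+_; _-_; _*_)
import Data.Integer.Tactic.RingSolver as ℤ-Solver
open import Data.Fin.Base using (Fin; opposite)
open import Data.Fin.Patterns using (0F; 1F)
import Data.Fin.Properties as Fin
open import Data.List.Base
  using (List; []; _∷_; [_]; _++_; _∷ʳ_; length; map; take; drop; filter; foldl; initLast; _∷ʳ′_)
open import Data.List.Properties
  using (length-++; length-take; length-map; ∷ʳ-injective; map-injective)
open import Data.List.Membership.Propositional using (_∈_; _∉_)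
open import Data.List.Membership.Propositional.Properties
  using (∈-∃++; ∈-++⁺ˡ; ∈-++⁺ʳ; ∈-++⁻; ∈-filter⁺; ∈-filter⁻)
open import Data.List.Relation.Unary.Any using (here; there)
import Data.List.Relation.Unary.All as All
import Data.List.Relation.Unary.AllPairs as AllPairs
open import Data.List.Relation.Unary.Unique.Propositional using (Unique)
import Data.List.Relation.Unary.Unique.Propositional.Properties as Unique
open import Data.List.Relation.Binary.Infix.Heterogeneous as Infix using (Infix; here; there)
open import Data.List.Relation.Binary.Infix.Heterogeneous.Properties as Infix using (fromSuffix)
open import Data.List.Relation.Binary.Prefix.Heterogeneous using (Prefix; []; _∷_)
open import Data.List.Relation.Binary.Suffix.Heterogeneous using (Suffix; here; there)
open import Data.List.Relation.Binary.Pointwise using (Pointwise-≡⇒≡; ≡⇒Pointwise-≡)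
open import Data.Product.Base using (_×_; _,_; ∃-syntax; ∃₂; proj₁; proj₂)
open import Data.Sum.Base using (_⊎_; inj₁; inj₂)
open import Function.Base using (id; _∘_)
open import Relation.Nullary using (contradiction; yes; no)
open import Relation.Nullary.Decidable using (_×-dec_; _→-dec_)
open import Relation.Unary using (Decidable)
open import Relation.Binary.PropositionalEquality hiding ([_])

-- Words encoded by their gaps

-- The word 0^g 1 0^x₁ 1 0^x₂ … 1 0^xₙ with gaps g and xs = x₁, …, xₙ.
enc : ℕ → List ℕ → Word
enc zero    []       = []
enc zero    (x ∷ xs) = 1F ∷ enc x xs
enc (suc g) xs       = 0F ∷ enc g xs

enc-surjective : ∀ w → ∃₂ λ g xs → w ≡ enc g xs
enc-surjective []       = zero , [] , refl
enc-surjective (0F ∷ w) with enc-surjective w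
... | g , xs , refl = suc g , xs , refl
enc-surjective (1F ∷ w) with enc-surjective w
... | g , xs , refl = zero , g ∷ xs , refl

enc-injective : ∀ g xs h ys → enc g xs ≡ enc h ys → g ≡ h × xs ≡ ys
enc-injective zero    []       zero    []       eq = refl , refl
enc-injective zero    (x ∷ xs) zero    (y ∷ ys) eq
  with enc-injective x xs y ys (cong (drop 1) eq)
... | refl , refl = refl , refl
enc-injective (suc g) xs       (suc h) ys       eq
  with enc-injective g xs h ys (cong (drop 1) eq)
... | refl , refl = refl , refl
enc-injective zero    []       zero    (_ ∷ _)  ()
enc-injective zero    []       (suc _) _        ()
enc-injective zero    (_ ∷ _)  zero    []       ()
enc-injective zero    (_ ∷ _)  (suc _) _        ()
enc-injective (suc _) _        zero    []       ()
enc-injective (suc _) _        zero    (_ ∷ _)  ()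

enc-zeros : ∀ g xs → ∣ enc g xs ∣[ 0F ] ≡ g ℕ.+ sum xs
enc-zeros zero    []       = refl
enc-zeros zero    (x ∷ xs) = enc-zeros x xs
enc-zeros (suc g) xs       = cong suc (enc-zeros g xs)

enc-height : ∀ g xs → height (enc g xs) ≡ length xs
enc-height zero    []       = refl
enc-height zero    (x ∷ xs) = cong suc (enc-height x xs)
enc-height (suc g) xs       = enc-height g xs

length≡zeros+height : ∀ w → length w ≡ ∣ w ∣[ 0F ] ℕ.+ height w
length≡zeros+height []       = refl
length≡zeros+height (0F ∷ w) = cong suc (length≡zeros+height w)
length≡zeros+height (1F ∷ w) =
  trans (cong suc (length≡zeros+height w)) (sym (ℕ.+-suc ∣ w ∣[ 0F ] (height w)))

enc-length : ∀ g xs → length (enc g xs) ≡ g ℕ.+ sum xs ℕ.+ length xs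
enc-length g xs = trans (length≡zeros+height (enc g xs))
  (cong₂ ℕ._+_ (enc-zeros g xs) (enc-height g xs))

-- Balance in terms of gaps

-- That vs ∷ʳ y, not just vs, occurs in xs means that the gaps vs lie between two 1's.
BalancedGaps : ℕ → List ℕ → Set
BalancedGaps g xs = ∀ us vs y → Infix _≡_ us (g ∷ xs) → Infix _≡_ (vs ∷ʳ y) xs →
                    length us ≡ length vs → sum us ≤ suc (sum vs)

prefix⇒gaps : ∀ g xs {u} → Prefix _≡_ u (enc g xs) →
  ∃[ us ] Prefix _≡_ us xs × length us ≡ height u × ∣ u ∣[ 0F ] ≤ g ℕ.+ sum us
prefix⇒gaps g       xs       {[]} _         = [] , [] , refl , z≤n
prefix⇒gaps zero    (x ∷ xs) (refl ∷ p) with prefix⇒gaps x xs p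
... | us , q , l , b = x ∷ us , refl ∷ q , cong suc l , b
prefix⇒gaps (suc g) xs       (refl ∷ p) with prefix⇒gaps g xs p
... | us , q , l , b = us , q , l , s≤s b

-- A subword with n ones meets n + 1 consecutive gaps. It may cut the first and the last of them
-- short, so the window only bounds its zeros from above.
subword⇒gaps : ∀ g xs {u} → Subword u (enc g xs) →
  ∃[ us ] Infix _≡_ us (g ∷ xs) × length us ≡ suc (height u) × ∣ u ∣[ 0F ] ≤ sum us
subword⇒gaps zero (x ∷ xs) (there p) with subword⇒gaps x xs p
... | us , q , l , b = us , there q , l , b
subword⇒gaps (suc g) xs (there p) with subword⇒gaps g xs p
... | []     , here [] , () , b
... | us     , there q , l , b = us , there q , l , b
... | g ∷ us , here (refl ∷ q) , l , b = suc g ∷ us , here (refl ∷ q) , l , ℕ.m≤n⇒m≤1+n b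
subword⇒gaps g xs (here p) with prefix⇒gaps g xs p
... | us , q , l , b = g ∷ us , here (refl ∷ q) , cong suc l , b

prefix⇒closedGaps : ∀ m g xs {v} → Prefix _≡_ v (enc g xs) → m ≤ height v →
  ∃₂ λ vs y → Prefix _≡_ (vs ∷ʳ y) (g ∷ xs) × length vs ≡ m × sum vs ≤ ∣ v ∣[ 0F ]
prefix⇒closedGaps zero    g xs p m≤ = [] , g , refl ∷ [] , refl , z≤n
prefix⇒closedGaps (suc m) zero (x ∷ xs) (refl ∷ p) (s≤s m≤) with prefix⇒closedGaps m x xs p m≤
... | vs , y , q , l , b = zero ∷ vs , y , refl ∷ q , cong suc l , b
prefix⇒closedGaps (suc m) (suc g) xs (refl ∷ p) m≤ with prefix⇒closedGaps (suc m) g xs p m≤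
... | g ∷ vs , y , refl ∷ q , l , b = suc g ∷ vs , y , refl ∷ q , l , s≤s b

-- The first m + 1 ones of `v` enclose m complete gaps, all of whose zeros lie in `v`. The entry `y`
-- is the gap after the last of these ones and witnesses that the window is closed.
subword⇒closedGaps : ∀ m g xs {v} → Subword v (enc g xs) → m < height v →
  ∃₂ λ vs y → Infix _≡_ (vs ∷ʳ y) xs × length vs ≡ m × sum vs ≤ ∣ v ∣[ 0F ]
subword⇒closedGaps m zero (x ∷ xs) (here (refl ∷ p)) (s≤s m<) with prefix⇒closedGaps m x xs p m<
... | vs , y , q , l , b = vs , y , here q , l , b
subword⇒closedGaps m (suc g) xs (here (refl ∷ p)) m< with subword⇒closedGaps m g xs (here p) m<
... | vs , y , q , l , b = vs , y , q , l , ℕ.m≤n⇒m≤1+n b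
subword⇒closedGaps m zero [] (here []) ()
subword⇒closedGaps m zero (x ∷ xs) (there p) m< with subword⇒closedGaps m x xs p m<
... | vs , y , q , l , b = vs , y , there q , l , b
subword⇒closedGaps m (suc g) xs (there p) m< = subword⇒closedGaps m g xs p m<

gaps⇒prefix : ∀ g {us xs} → Prefix _≡_ us xs → Prefix _≡_ (enc g us) (enc g xs)
gaps⇒prefix zero    {[]}   _          = []
gaps⇒prefix zero    {_ ∷ _} (refl ∷ p) = refl ∷ gaps⇒prefix _ p
gaps⇒prefix (suc g) p          = refl ∷ gaps⇒prefix g p

infix-after-gap : ∀ g {u x xs} → Subword u (1F ∷ enc x xs) → Subword u (enc g (x ∷ xs))
infix-after-gap zero    p = p
infix-after-gap (suc g) p = there (infix-after-gap g p)

gaps⇒subword : ∀ {u us} g xs → Infix _≡_ (u ∷ us) (g ∷ xs) → Subword (enc u us) (enc g xs)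
gaps⇒subword g xs       (here (refl ∷ p)) = here (gaps⇒prefix g p)
gaps⇒subword g (x ∷ xs) (there p)         = infix-after-gap g (there (gaps⇒subword x xs p))
gaps⇒subword g []       (there (here ()))

closedGaps⇒prefix : ∀ v {vs y xs} → Prefix _≡_ (vs ∷ʳ y) xs →
  Prefix _≡_ (enc v vs ∷ʳ 1F) (enc v xs)
closedGaps⇒prefix zero    {[]}     (refl ∷ p) = refl ∷ []
closedGaps⇒prefix zero    {x ∷ vs} (refl ∷ p) = refl ∷ closedGaps⇒prefix x p
closedGaps⇒prefix (suc v) p                   = refl ∷ closedGaps⇒prefix v p

closedGaps⇒subword : ∀ {v vs y} g xs → Infix _≡_ (v ∷ vs ∷ʳ y) xs →
  Subword (1F ∷ enc v vs ∷ʳ 1F) (enc g xs)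
closedGaps⇒subword g (x ∷ xs) (here (refl ∷ p)) =
  infix-after-gap g (here (refl ∷ closedGaps⇒prefix _ p))
closedGaps⇒subword g (x ∷ xs) (there p) =
  infix-after-gap g (there (closedGaps⇒subword x xs p))

zeros-∷ʳ1 : ∀ w → ∣ w ∷ʳ 1F ∣[ 0F ] ≡ ∣ w ∣[ 0F ]
zeros-∷ʳ1 []       = refl
zeros-∷ʳ1 (0F ∷ w) = cong suc (zeros-∷ʳ1 w)
zeros-∷ʳ1 (1F ∷ w) = zeros-∷ʳ1 w

take-prefix : ∀ n (u : Word) → Prefix _≡_ (take n u) u
take-prefix zero    u       = []
take-prefix (suc n) []      = []
take-prefix (suc n) (x ∷ u) = refl ∷ take-prefix n u

height-prefix : ∀ {u w} → Prefix _≡_ u w → height u ≤ height w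
height-prefix []                  = z≤n
height-prefix (_∷_ {0F} refl p) = height-prefix p
height-prefix (_∷_ {1F} refl p) = s≤s (height-prefix p)

prefix-subword-trans : ∀ {t u w : Word} → Prefix _≡_ t u → Subword u w → Subword t w
prefix-subword-trans = Infix.Prefix-Infix-trans trans

∣m-n∣≤1⇒m≤1+n : ∀ m n → ∣ m - n ∣ ≤ 1 → m ≤ suc n
∣m-n∣≤1⇒m≤1+n m n d = ℕ.≤-trans (ℕ.m≤n+∣m-n∣ m n)
  (ℕ.≤-trans (ℕ.+-monoʳ-≤ n d) (ℕ.≤-reflexive (ℕ.+-comm n 1)))

-- Suppose the sum of `u ∷ us` exceeds that of `v ∷ vs` by 2 or more. Then `U` is at least as long
-- as `V`, the closed window together with its two bounding ones. The prefix `t` of `U` of the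
-- length of `V` has at most `length us` ones, hence at least two more zeros than `V`.
balanced⇒balancedGaps : ∀ g xs → Balanced (enc g xs) → BalancedGaps g xs
balanced⇒balancedGaps g xs bal [] vs y p q eq = z≤n
balanced⇒balancedGaps g xs bal (u ∷ us) (v ∷ vs) y p q eq
  with sum (u ∷ us) ℕ.≤? suc (sum (v ∷ vs))
... | yes le = le
... | no ¬le = contradiction
  (∣m-n∣≤1⇒m≤1+n _ _ (bal t V (prefix-subword-trans (take-prefix _ U) U⊑w)
    (closedGaps⇒subword g xs q) lenT))
  (ℕ.<⇒≱ big)
  where
  U = enc u us
  V = 1F ∷ enc v vs ∷ʳ 1F
  t = take (length V) U
  U⊑w = gaps⇒subword g xs p
  lenV : length V ≡ 2 ℕ.+ (sum (v ∷ vs) ℕ.+ length us)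
  lenV = cong suc (trans (length-++ (enc v vs)) (trans (ℕ.+-comm _ 1)
    (cong suc (trans (enc-length v vs) (cong (v ℕ.+ sum vs ℕ.+_) (sym (ℕ.suc-injective eq)))))))
  V≤U : length V ≤ length U
  V≤U = ℕ.≤-trans (ℕ.≤-reflexive lenV)
    (ℕ.≤-trans (ℕ.+-monoˡ-≤ (length us) (ℕ.≰⇒> ¬le)) (ℕ.≤-reflexive (sym (enc-length u us))))
  lenT : length t ≡ length V
  lenT = trans (length-take (length V) U) (ℕ.m≤n⇒m⊓n≡m V≤U)
  zerosV : ∣ V ∣[ 0F ] ≡ sum (v ∷ vs)
  zerosV = trans (zeros-∷ʳ1 (enc v vs)) (enc-zeros v vs)
  big : suc ∣ V ∣[ 0F ] < ∣ t ∣[ 0F ]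
  big = ℕ.+-cancelʳ-≤ (length us) _ _ (begin
    2 ℕ.+ ∣ V ∣[ 0F ] ℕ.+ length us       ≡⟨ cong (λ z → 2 ℕ.+ z ℕ.+ length us) zerosV ⟩
    2 ℕ.+ (sum (v ∷ vs) ℕ.+ length us)    ≡⟨ lenV ⟨
    length V                              ≡⟨ lenT ⟨
    length t                              ≡⟨ length≡zeros+height t ⟩
    ∣ t ∣[ 0F ] ℕ.+ height t
      ≤⟨ ℕ.+-monoʳ-≤ ∣ t ∣[ 0F ] (height-prefix (take-prefix (length V) U)) ⟩
    ∣ t ∣[ 0F ] ℕ.+ height U              ≡⟨ cong (∣ t ∣[ 0F ] ℕ.+_) (enc-height u us) ⟩
    ∣ t ∣[ 0F ] ℕ.+ length us             ∎)
    where open ℕ.≤-Reasoning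

-- If `u` had two more zeros than `v`, then `v` would have two more ones than `u`. So `v` would
-- contain `suc (height u)` closed gaps, as many as suffice to cover `u`, and the gap condition
-- compares the two windows.
balancedGaps⇒≤ : ∀ g xs → BalancedGaps g xs → ∀ u v → Subword u (enc g xs) → Subword v (enc g xs) →
  length u ≡ length v → ∣ u ∣[ 0F ] ≤ suc ∣ v ∣[ 0F ]
balancedGaps⇒≤ g xs bal u v p q eq with ∣ u ∣[ 0F ] ℕ.≤? suc ∣ v ∣[ 0F ]
... | yes le = le
... | no ¬le with subword⇒gaps g xs p | subword⇒closedGaps (suc (height u)) g xs q height<
  where
  height< : suc (height u) < height v
  height< = ℕ.+-cancelˡ-≤ ∣ v ∣[ 0F ] _ _ (begin
    ∣ v ∣[ 0F ] ℕ.+ (2 ℕ.+ height u)   ≡⟨ ℕ.+-assoc ∣ v ∣[ 0F ] 2 (height u) ⟨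
    ∣ v ∣[ 0F ] ℕ.+ 2 ℕ.+ height u     ≡⟨ cong (ℕ._+ height u) (ℕ.+-comm ∣ v ∣[ 0F ] 2) ⟩
    2 ℕ.+ ∣ v ∣[ 0F ] ℕ.+ height u     ≤⟨ ℕ.+-monoˡ-≤ (height u) (ℕ.≰⇒> ¬le) ⟩
    ∣ u ∣[ 0F ] ℕ.+ height u           ≡⟨ length≡zeros+height u ⟨
    length u                           ≡⟨ eq ⟩
    length v                           ≡⟨ length≡zeros+height v ⟩
    ∣ v ∣[ 0F ] ℕ.+ height v           ∎)
    where open ℕ.≤-Reasoning
... | us , p′ , l , b | vs , y , q′ , l′ , b′ =
  ℕ.≤-trans b (ℕ.≤-trans (bal us vs y p′ q′ (trans l (sym l′))) (s≤s b′))

balancedGaps⇒balanced : ∀ g xs → BalancedGaps g xs → Balanced (enc g xs)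
balancedGaps⇒balanced g xs bal u v p q eq with ℕ.≤-total ∣ u ∣[ 0F ] ∣ v ∣[ 0F ]
... | inj₁ u≤v = ℕ.≤-trans (ℕ.≤-reflexive (ℕ.m≤n⇒∣m-n∣≡n∸m u≤v))
  (ℕ.m≤n+o⇒m∸n≤o _ ∣ u ∣[ 0F ] (ℕ.≤-trans (balancedGaps⇒≤ g xs bal v u q p (sym eq))
    (ℕ.≤-reflexive (ℕ.+-comm 1 ∣ u ∣[ 0F ]))))
... | inj₂ v≤u = ℕ.≤-trans (ℕ.≤-reflexive (ℕ.m≤n⇒∣n-m∣≡n∸m v≤u))
  (ℕ.m≤n+o⇒m∸n≤o _ ∣ v ∣[ 0F ] (ℕ.≤-trans (balancedGaps⇒≤ g xs bal u v p q eq)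
    (ℕ.≤-reflexive (ℕ.+-comm 1 ∣ v ∣[ 0F ]))))

-- Inner windows and windows reaching one end

sum-∷ʳ : ∀ xs z → sum (xs ∷ʳ z) ≡ z ℕ.+ sum xs
sum-∷ʳ xs z = trans (sum-++ xs [ z ])
  (trans (cong (sum xs ℕ.+_) (ℕ.+-identityʳ z)) (ℕ.+-comm (sum xs) z))

length-∷ʳ : ∀ {A : Set} (xs : List A) z → length (xs ∷ʳ z) ≡ suc (length xs)
length-∷ʳ xs z = trans (length-++ xs) (ℕ.+-comm (length xs) 1)

sum-map-suc : ∀ xs → sum (map suc xs) ≡ length xs ℕ.+ sum xs
sum-map-suc []       = refl
sum-map-suc (x ∷ xs) = cong suc (begin
  x ℕ.+ sum (map suc xs)            ≡⟨ cong (x ℕ.+_) (sum-map-suc xs) ⟩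
  x ℕ.+ (length xs ℕ.+ sum xs)      ≡⟨ ℕ.+-assoc x (length xs) (sum xs) ⟨
  x ℕ.+ length xs ℕ.+ sum xs        ≡⟨ cong (ℕ._+ sum xs) (ℕ.+-comm x (length xs)) ⟩
  length xs ℕ.+ x ℕ.+ sum xs        ≡⟨ ℕ.+-assoc (length xs) x (sum xs) ⟩
  length xs ℕ.+ (x ℕ.+ sum xs)      ∎)
  where open ≡-Reasoning

-- The appended `z` guarantees that every window of `xs` is followed by some entry, as the closed
-- windows of `BalancedGaps` require.
prefix-∷ʳ⁺ : ∀ {vs xs} {z : ℕ} → Prefix _≡_ vs xs → ∃[ y ] Prefix _≡_ (vs ∷ʳ y) (xs ∷ʳ z)
prefix-∷ʳ⁺ {xs = []}    {z} [] = z , refl ∷ []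
prefix-∷ʳ⁺ {xs = x ∷ _}     [] = x , refl ∷ []
prefix-∷ʳ⁺ (refl ∷ p) with prefix-∷ʳ⁺ p
... | y , q = y , refl ∷ q

infix-∷ʳ⁺ : ∀ {vs xs} {z : ℕ} → Infix _≡_ vs xs → ∃[ y ] Infix _≡_ (vs ∷ʳ y) (xs ∷ʳ z)
infix-∷ʳ⁺ (here p) with prefix-∷ʳ⁺ p
... | y , q = y , here q
infix-∷ʳ⁺ (there p) with infix-∷ʳ⁺ p
... | y , q = y , there q

suffix-∷ʳ⁺ : ∀ {us xs} {z : ℕ} → Suffix _≡_ us xs → Infix _≡_ (us ∷ʳ z) (xs ∷ʳ z)
suffix-∷ʳ⁺ (here eq) with Pointwise-≡⇒≡ eq
... | refl = Infix.fromPointwise (≡⇒Pointwise-≡ refl)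
suffix-∷ʳ⁺ (there p) = there (suffix-∷ʳ⁺ p)

prefix-∷ʳ⁻ : ∀ {us : List ℕ} {z} xs → Prefix _≡_ us (xs ∷ʳ z) → Prefix _≡_ us xs ⊎ us ≡ xs ∷ʳ z
prefix-∷ʳ⁻ []       []          = inj₁ []
prefix-∷ʳ⁻ (x ∷ xs) []          = inj₁ []
prefix-∷ʳ⁻ []       (refl ∷ []) = inj₂ refl
prefix-∷ʳ⁻ (x ∷ xs) (refl ∷ p) with prefix-∷ʳ⁻ xs p
... | inj₁ q    = inj₁ (refl ∷ q)
... | inj₂ refl = inj₂ refl

infix-∷ʳ⁻ : ∀ {us : List ℕ} {z} xs → Infix _≡_ us (xs ∷ʳ z) →
  Infix _≡_ us xs ⊎ ∃[ us′ ] us ≡ us′ ∷ʳ z × Suffix _≡_ us′ xs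
infix-∷ʳ⁻ []       (there (here [])) = inj₁ (here [])
infix-∷ʳ⁻ (x ∷ xs) (there p) with infix-∷ʳ⁻ xs p
... | inj₁ q              = inj₁ (there q)
... | inj₂ (us′ , eq , q) = inj₂ (us′ , eq , there q)
infix-∷ʳ⁻ xs (here p) with prefix-∷ʳ⁻ xs p
... | inj₁ q    = inj₁ (here q)
... | inj₂ refl = inj₂ (xs , refl , here (≡⇒Pointwise-≡ refl))

prefix-init : ∀ {vs xs} {y : ℕ} → Prefix _≡_ (vs ∷ʳ y) xs → Prefix _≡_ vs xs
prefix-init {[]}     p          = []
prefix-init {v ∷ vs} (refl ∷ p) = refl ∷ prefix-init p

infix-init : ∀ {vs xs} {y : ℕ} → Infix _≡_ (vs ∷ʳ y) xs → Infix _≡_ vs xs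
infix-init (here p)  = here (prefix-init p)
infix-init (there p) = there (infix-init p)

infix-tail : ∀ {v : ℕ} {vs xs} → Infix _≡_ (v ∷ vs) xs → Infix _≡_ vs xs
infix-tail (here (_ ∷ p)) = there (here p)
infix-tail (there p)      = there (infix-tail p)

-- d and g are the number and the total of the outer gaps by which the windows us are
-- completed: d = 0 for inner windows, d = 1 for those reaching one end of the word.
Dominated : (List ℕ → List ℕ → Set) → ℕ → ℕ → List ℕ → Set
Dominated _⊑_ d g xs = ∀ us vs → us ⊑ xs → Infix _≡_ vs xs → d ℕ.+ length us ≡ length vs →
                       g ℕ.+ sum us ≤ suc (sum vs)

BalancedParts : ℕ → List ℕ → ℕ → Set
BalancedParts g xs z = Dominated (Infix _≡_) 0 0 xs × Dominated (Prefix _≡_) 1 g xs ×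
                       Dominated (Suffix _≡_) 1 z xs

balancedGaps⇒parts : ∀ g xs z → BalancedGaps g (xs ∷ʳ z) → BalancedParts g xs z
balancedGaps⇒parts g xs z bal = inner , left , right
  where
  inner : Dominated (Infix _≡_) 0 0 xs
  inner us vs p q eq with infix-∷ʳ⁺ p | infix-∷ʳ⁺ q
  ... | _ , p′ | y , q′ = bal us vs y (there (infix-init p′)) q′ eq
  left : Dominated (Prefix _≡_) 1 g xs
  left us vs p q eq with prefix-∷ʳ⁺ p | infix-∷ʳ⁺ q
  ... | _ , p′ | y , q′ = bal (g ∷ us) vs y (here (refl ∷ prefix-init p′)) q′ eq
  right : Dominated (Suffix _≡_) 1 z xs
  right us vs p q eq with infix-∷ʳ⁺ q
  ... | y , q′ = subst (_≤ suc (sum vs)) (sum-∷ʳ us z)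
    (bal (us ∷ʳ z) vs y (there (suffix-∷ʳ⁺ p)) q′ (trans (length-∷ʳ us z) eq))

parts⇒balancedGaps : ∀ g xs z → BalancedParts g xs z → BalancedGaps g (xs ∷ʳ z)
parts⇒balancedGaps g xs z (inner , left , right) us vs y p q = go us p
  where
  -- The closing entry `y` may be the last gap `z` itself; in either case `vs` consists of inner
  -- gaps.
  q′ : Infix _≡_ vs xs
  q′ with infix-∷ʳ⁻ xs q
  ... | inj₁ r = infix-init r
  ... | inj₂ (us′ , eq , r) with ∷ʳ-injective vs us′ eq
  ... | refl , _ = fromSuffix r
  go : ∀ us → Infix _≡_ us (g ∷ xs ∷ʳ z) → length us ≡ length vs → sum us ≤ suc (sum vs)
  go us (there p) eq with infix-∷ʳ⁻ xs p
  ... | inj₁ r = inner us vs r q′ eq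
  ... | inj₂ (us′ , refl , r) = subst (_≤ suc (sum vs)) (sym (sum-∷ʳ us′ z))
    (right us′ vs r q′ (trans (sym (length-∷ʳ us′ z)) eq))
  go []       (here p) eq = z≤n
  go (_ ∷ us) (here (refl ∷ p)) eq with prefix-∷ʳ⁻ xs p
  ... | inj₁ r = left us vs r q′ eq
  -- A window containing both outer gaps is longer than the whole list of inner gaps, so there is no
  -- `vs` to compare it with.
  ... | inj₂ refl = contradiction (Infix.length-mono q′) (ℕ.<⇒≱ (begin-strict
    length xs               <⟨ ℕ.n<1+n _ ⟩
    suc (length xs)         ≡⟨ length-∷ʳ xs z ⟨
    length (xs ∷ʳ z)        <⟨ ℕ.n<1+n _ ⟩
    suc (length (xs ∷ʳ z))  ≡⟨ eq ⟩
    length vs               ∎))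
    where open ℕ.≤-Reasoning

-- Adding 1 to every gap

-- A vanishing outer gap imposes no condition of its own: dropping the first gap of
-- the window it is compared with leaves a comparison between inner windows.
dominated-zero : ∀ (_⊑_ : List ℕ → List ℕ → Set) {xs} → (∀ {us} → us ⊑ xs → Infix _≡_ us xs) →
  Dominated (Infix _≡_) 0 0 xs → Dominated _⊑_ 1 0 xs
dominated-zero _ ⊑⇒infix inner us (v ∷ vs) p q eq = ℕ.≤-trans
  (inner us vs (⊑⇒infix p) (infix-tail q) (ℕ.suc-injective eq))
  (s≤s (ℕ.m≤n+m (sum vs) v))

-- Infixes, prefixes and suffixes all have this property, which allows one treatment of growth for
-- the three kinds of windows.
record MapClosed (_⊑_ : List ℕ → List ℕ → Set) : Set where
  field
    map⁺ : ∀ {us xs} → us ⊑ xs → map suc us ⊑ map suc xs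
    map⁻ : ∀ {us} xs → us ⊑ map suc xs → ∃[ us′ ] us ≡ map suc us′ × us′ ⊑ xs

prefix-map⁺ : ∀ {us xs} → Prefix _≡_ us xs → Prefix _≡_ (map suc us) (map suc xs)
prefix-map⁺ []         = []
prefix-map⁺ (refl ∷ p) = refl ∷ prefix-map⁺ p

prefix-map⁻ : ∀ {us} xs → Prefix _≡_ us (map suc xs) → ∃[ us′ ] us ≡ map suc us′ × Prefix _≡_ us′ xs
prefix-map⁻ []       []         = [] , refl , []
prefix-map⁻ (x ∷ xs) []         = [] , refl , []
prefix-map⁻ (x ∷ xs) (refl ∷ p) with prefix-map⁻ xs p
... | us′ , refl , q = x ∷ us′ , refl , refl ∷ q

infix-map⁺ : ∀ {us xs} → Infix _≡_ us xs → Infix _≡_ (map suc us) (map suc xs)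
infix-map⁺ (here p)  = here (prefix-map⁺ p)
infix-map⁺ (there p) = there (infix-map⁺ p)

infix-map⁻ : ∀ {us} xs → Infix _≡_ us (map suc xs) → ∃[ us′ ] us ≡ map suc us′ × Infix _≡_ us′ xs
infix-map⁻ (x ∷ xs) (there p) with infix-map⁻ xs p
... | us′ , eq , q = us′ , eq , there q
infix-map⁻ xs (here p) with prefix-map⁻ xs p
... | us′ , eq , q = us′ , eq , here q

suffix-map⁺ : ∀ {us xs} → Suffix _≡_ us xs → Suffix _≡_ (map suc us) (map suc xs)
suffix-map⁺ (here eq) with Pointwise-≡⇒≡ eq
... | refl = here (≡⇒Pointwise-≡ refl)
suffix-map⁺ (there p) = there (suffix-map⁺ p)

suffix-map⁻ : ∀ {us} xs → Suffix _≡_ us (map suc xs) → ∃[ us′ ] us ≡ map suc us′ × Suffix _≡_ us′ xs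
suffix-map⁻ (x ∷ xs) (there p) with suffix-map⁻ xs p
... | us′ , eq , q = us′ , eq , there q
suffix-map⁻ xs (here eq) = xs , Pointwise-≡⇒≡ eq , here (≡⇒Pointwise-≡ refl)

infix-mapClosed : MapClosed (Infix _≡_)
infix-mapClosed = record { map⁺ = infix-map⁺ ; map⁻ = infix-map⁻ }

prefix-mapClosed : MapClosed (Prefix _≡_)
prefix-mapClosed = record { map⁺ = prefix-map⁺ ; map⁻ = prefix-map⁻ }

suffix-mapClosed : MapClosed (Suffix _≡_)
suffix-mapClosed = record { map⁺ = suffix-map⁺ ; map⁻ = suffix-map⁻ }

module _ {_⊑_ : List ℕ → List ℕ → Set} (closed : MapClosed _⊑_) (d g : ℕ) (xs : List ℕ) where
  open MapClosed closed

  private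
    lhs : ∀ us → d ℕ.+ g ℕ.+ sum (map suc us) ≡ (d ℕ.+ length us) ℕ.+ (g ℕ.+ sum us)
    lhs us = trans (cong (d ℕ.+ g ℕ.+_) (sum-map-suc us)) (interchange d g (length us) (sum us))
      where
      interchange : ∀ a b c e → a ℕ.+ b ℕ.+ (c ℕ.+ e) ≡ a ℕ.+ c ℕ.+ (b ℕ.+ e)
      interchange = ℕ-Solver.solve-∀
    rhs : ∀ (us vs : List ℕ) → d ℕ.+ length us ≡ length vs →
      suc (sum (map suc vs)) ≡ (d ℕ.+ length us) ℕ.+ suc (sum vs)
    rhs us vs eq = trans (cong suc (sum-map-suc vs))
      (trans (sym (ℕ.+-suc (length vs) (sum vs))) (cong (ℕ._+ suc (sum vs)) (sym eq)))

  -- The two windows compared have the same number `d + length us` of gaps, outer gaps included, so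
  -- growth adds the same amount to both sides.
  dominated-map⁺ : Dominated _⊑_ d g xs → Dominated _⊑_ d (d ℕ.+ g) (map suc xs)
  dominated-map⁺ dom us vs p q eq with map⁻ xs p | infix-map⁻ xs q
  ... | us , refl , p′ | vs , refl , q′ = subst₂ _≤_ (sym (lhs us)) (sym (rhs us vs eq′))
    (ℕ.+-monoʳ-≤ (d ℕ.+ length us) (dom us vs p′ q′ eq′))
    where eq′ = trans (cong (d ℕ.+_) (sym (length-map suc us))) (trans eq (length-map suc vs))

  dominated-map⁻ : Dominated _⊑_ d (d ℕ.+ g) (map suc xs) → Dominated _⊑_ d g xs
  dominated-map⁻ dom us vs p q eq = ℕ.+-cancelˡ-≤ (d ℕ.+ length us) _ _
    (subst₂ _≤_ (lhs us) (rhs us vs eq) (dom (map suc us) (map suc vs) (map⁺ p) (infix-map⁺ q)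
      (trans (cong (d ℕ.+_) (length-map suc us)) (trans eq (sym (length-map suc vs))))))

-- The outer gap at an end with letter a grows by growth a: a gap 0, at an end with
-- letter 1, is kept so that the end letter is preserved.
growth : Fin 2 → ℕ
growth 0F = 1
growth 1F = 0

-- These are exactly the gaps `g` for which `growth a + g` is the outer gap at an end with letter
-- `a`.
Trimmed : Fin 2 → ℕ → Set
Trimmed a g = a ≡ 1F → g ≡ 0

module _ {_⊑_ : List ℕ → List ℕ → Set} (closed : MapClosed _⊑_)
         (⊑⇒infix : ∀ {us xs} → us ⊑ xs → Infix _≡_ us xs) where

  -- At an end 0 the outer gap grows with the others. At an end 1 it stays 0, and its condition
  -- follows from the one on the grown inner gaps.
  dominated-grow⁺ : ∀ a {g xs} → Trimmed a g → Dominated (Infix _≡_) 0 0 (map suc xs) →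
    Dominated _⊑_ 1 g xs → Dominated _⊑_ 1 (growth a ℕ.+ g) (map suc xs)
  dominated-grow⁺ 0F t inner dom = dominated-map⁺ closed 1 _ _ dom
  dominated-grow⁺ 1F t inner dom rewrite t refl = dominated-zero _⊑_ ⊑⇒infix inner

  dominated-grow⁻ : ∀ a {g xs} → Trimmed a g → Dominated (Infix _≡_) 0 0 xs →
    Dominated _⊑_ 1 (growth a ℕ.+ g) (map suc xs) → Dominated _⊑_ 1 g xs
  dominated-grow⁻ 0F t inner dom = dominated-map⁻ closed 1 _ _ dom
  dominated-grow⁻ 1F t inner dom rewrite t refl = dominated-zero _⊑_ ⊑⇒infix inner

parts-grow⁺ : ∀ a b {g xs z} → Trimmed a g → Trimmed b z → BalancedParts g xs z →
  BalancedParts (growth a ℕ.+ g) (map suc xs) (growth b ℕ.+ z)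
parts-grow⁺ a b t t′ (inner , left , right) =
  inner′ , dominated-grow⁺ prefix-mapClosed here a t inner′ left
         , dominated-grow⁺ suffix-mapClosed fromSuffix b t′ inner′ right
  where inner′ = dominated-map⁺ infix-mapClosed 0 0 _ inner

parts-grow⁻ : ∀ a b {g xs z} → Trimmed a g → Trimmed b z →
  BalancedParts (growth a ℕ.+ g) (map suc xs) (growth b ℕ.+ z) → BalancedParts g xs z
parts-grow⁻ a b t t′ (inner , left , right) =
  inner′ , dominated-grow⁻ prefix-mapClosed here a t inner′ left
         , dominated-grow⁻ suffix-mapClosed fromSuffix b t′ inner′ right
  where inner′ = dominated-map⁻ infix-mapClosed 0 0 _ inner

-- Words with an inner gap 0

shrink? : ∀ xs → (∃[ ys ] xs ≡ map suc ys) ⊎ Infix _≡_ [ 0 ] xs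
shrink? [] = inj₁ ([] , refl)
shrink? (zero ∷ xs) = inj₂ (here (refl ∷ []))
shrink? (suc x ∷ xs) with shrink? xs
... | inj₁ (ys , refl) = inj₁ (x ∷ ys , refl)
... | inj₂ p = inj₂ (there p)

sum≤length : ∀ xs → (∀ {x} → Infix _≡_ [ x ] xs → x ≤ 1) → sum xs ≤ length xs
sum≤length []       le = z≤n
sum≤length (x ∷ xs) le =
  ℕ.+-mono-≤ (le (here (refl ∷ []))) (sum≤length xs (λ p → le (there p)))

sum<length : ∀ {xs} → (∀ {x} → Infix _≡_ [ x ] xs → x ≤ 1) → Infix _≡_ [ 0 ] xs →
  sum xs < length xs
sum<length {_ ∷ xs} le (here (refl ∷ _)) = s≤s (sum≤length xs (λ p → le (there p)))
sum<length {_ ∷ xs} le (there p) =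
  ℕ.+-mono-≤-< (le (here (refl ∷ []))) (sum<length (λ p → le (there p)) p)

-- Comparison with the one-gap window `[ 0 ]` bounds every gap by 1. Hence a word with an inner gap
-- 0 is short, which is how the length hypothesis of `#ends-grow` rules it out.
inner-zero⇒scarce : ∀ {g xs z} → BalancedParts g xs z → Infix _≡_ [ 0 ] xs →
  g ≤ 1 × z ≤ 1 × sum xs < length xs
inner-zero⇒scarce {g} {xs} {z} (inner , left , right) 0∈ =
  subst (_≤ 1) (ℕ.+-identityʳ g) (left [] [ 0 ] [] 0∈ refl) ,
  subst (_≤ 1) (ℕ.+-identityʳ z) (right [] [ 0 ] (suffix-[] xs) 0∈ refl) ,
  sum<length (λ {x} p → subst (_≤ 1) (ℕ.+-identityʳ x) (inner [ x ] [ 0 ] p 0∈ refl)) 0∈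
  where
  suffix-[] : ∀ (xs : List ℕ) → Suffix _≡_ [] xs
  suffix-[] []       = here (≡⇒Pointwise-≡ refl)
  suffix-[] (x ∷ xs) = there (suffix-[] xs)

-- Counting by injections and by end letters

-- Pigeonhole principle: each `x = f i` uses up the entry `g i` of `ys`. Applied a second time with
-- `f` and `g` exchanged, it turns two parametrizations by the same indices into an equality of
-- lengths.
length-≤-via : ∀ {I A B : Set} {xs : List A} {ys : List B} (f : I → A) (g : I → B) →
  (∀ {i j} → g i ≡ g j → i ≡ j) → Unique xs →
  (∀ {x} → x ∈ xs → ∃[ i ] x ≡ f i × g i ∈ ys) → length xs ≤ length ys
length-≤-via {xs = []}     f g inj _ cover = z≤n
length-≤-via {xs = x ∷ xs} f g inj (x∉ AllPairs.∷ uniq) cover with cover (here refl)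
... | i , x≡fi , gi∈ with ∈-∃++ gi∈
... | ys₁ , ys₂ , refl = ℕ.≤-trans (s≤s (length-≤-via f g inj uniq cover′))
  (ℕ.≤-reflexive (trans (cong suc (length-++ ys₁))
    (trans (sym (ℕ.+-suc (length ys₁) (length ys₂))) (sym (length-++ ys₁)))))
  where
  cover′ : ∀ {x′} → x′ ∈ xs → ∃[ j ] x′ ≡ f j × g j ∈ ys₁ ++ ys₂
  cover′ x′∈ with cover (there x′∈)
  ... | j , refl , gj∈ with ∈-++⁻ ys₁ gj∈
  ... | inj₁ ∈₁ = j , refl , ∈-++⁺ˡ ∈₁
  ... | inj₂ (there ∈₂) = j , refl , ∈-++⁺ʳ ys₁ ∈₂
  -- If the entry already removed were needed again, injectivity would make `x′` a repetition of
  -- `x`.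
  ... | inj₂ (here gj≡gi) =
    contradiction (trans x≡fi (cong f (sym (inj gj≡gi)))) (All.lookup x∉ x′∈)

-- The empty word is given the end letters 0.
first : Word → Fin 2
first []      = 0F
first (x ∷ _) = x

last : Word → Fin 2
last = foldl (λ _ x → x) 0F

-- `HasEnds a b` describes words after growth and `Trims a b` words before it: growth turns either
-- letter at an end into 0, whereas an end that is to be 1 must be 1 already.
HasEnds Trims : Fin 2 → Fin 2 → Word → Set
HasEnds a b w = first w ≡ a × last w ≡ b
Trims a b w = (a ≡ 1F → first w ≡ 1F) × (b ≡ 1F → last w ≡ 1F)

hasEnds? : ∀ a b → Decidable (HasEnds a b)
hasEnds? a b w = (first w Fin.≟ a) ×-dec (last w Fin.≟ b)

trims? : ∀ a b → Decidable (Trims a b)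
trims? a b w = ((a Fin.≟ 1F) →-dec (first w Fin.≟ 1F)) ×-dec ((b Fin.≟ 1F) →-dec (last w Fin.≟ 1F))

#ends #trims : Fin 2 → Fin 2 → List Word → ℕ
#ends a b ws = length (filter (hasEnds? a b) ws)
#trims a b ws = length (filter (trims? a b) ws)

#trims-11 : ∀ ws → #trims 1F 1F ws ≡ #ends 1F 1F ws
#trims-11 [] = refl
#trims-11 (w ∷ ws) with first w | last w
... | 0F | 0F = #trims-11 ws
... | 0F | 1F = #trims-11 ws
... | 1F | 0F = #trims-11 ws
... | 1F | 1F = cong suc (#trims-11 ws)

#trims-01 : ∀ ws → #trims 0F 1F ws ≡ #ends 0F 1F ws ℕ.+ #ends 1F 1F ws
#trims-01 [] = refl
#trims-01 (w ∷ ws) with first w | last w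
... | 0F | 0F = #trims-01 ws
... | 0F | 1F = cong suc (#trims-01 ws)
... | 1F | 0F = #trims-01 ws
... | 1F | 1F = trans (cong suc (#trims-01 ws)) (sym (ℕ.+-suc _ _))

#trims-10 : ∀ ws → #trims 1F 0F ws ≡ #ends 1F 0F ws ℕ.+ #ends 1F 1F ws
#trims-10 [] = refl
#trims-10 (w ∷ ws) with first w | last w
... | 0F | 0F = #trims-10 ws
... | 0F | 1F = #trims-10 ws
... | 1F | 0F = cong suc (#trims-10 ws)
... | 1F | 1F = trans (cong suc (#trims-10 ws)) (sym (ℕ.+-suc _ _))

#trims-00 : ∀ ws → #trims 0F 0F ws ≡ length ws
#trims-00 [] = refl
#trims-00 (w ∷ ws) = cong suc (#trims-00 ws)

#ends-total : ∀ ws → length ws ≡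
  #ends 0F 0F ws ℕ.+ #ends 0F 1F ws ℕ.+ (#ends 1F 0F ws ℕ.+ #ends 1F 1F ws)
#ends-total [] = refl
#ends-total (w ∷ ws) with first w | last w
... | 0F | 0F = cong suc (#ends-total ws)
... | 0F | 1F = trans (cong suc (#ends-total ws)) (cong (ℕ._+ (#ends 1F 0F ws ℕ.+ #ends 1F 1F ws))
  (sym (ℕ.+-suc (#ends 0F 0F ws) (#ends 0F 1F ws))))
... | 1F | 0F = trans (cong suc (#ends-total ws)) (sym (ℕ.+-suc _ _))
... | 1F | 1F = trans (cong suc (#ends-total ws))
  (trans (sym (ℕ.+-suc _ _)) (cong (#ends 0F 0F ws ℕ.+ #ends 0F 1F ws ℕ.+_)
    (sym (ℕ.+-suc (#ends 1F 0F ws) (#ends 1F 1F ws)))))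

-- The end letter that an outer gap produces in a word containing a 1.
edge : ℕ → Fin 2
edge zero    = 1F
edge (suc _) = 0F

first-enc : ∀ g xs z → first (enc g (xs ∷ʳ z)) ≡ edge g
first-enc zero    []       z = refl
first-enc zero    (_ ∷ _)  z = refl
first-enc (suc g) xs       z = refl

last-enc : ∀ g xs z → last (enc g (xs ∷ʳ z)) ≡ edge z
last-enc = go 0F
  where
  zeros : ∀ g → foldl (λ _ x → x) 0F (enc g []) ≡ 0F
  zeros zero    = refl
  zeros (suc g) = zeros g
  go : ∀ d g xs z → foldl (λ _ x → x) d (enc g (xs ∷ʳ z)) ≡ edge z
  go d zero    []       zero    = refl
  go d zero    []       (suc z) = zeros z
  go d zero    (x ∷ xs) z       = go 1F x xs z
  go d (suc g) xs       z       = go 0F g xs z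

edge-grow : ∀ a {g} → Trimmed a g → edge (growth a ℕ.+ g) ≡ a
edge-grow 0F t = refl
edge-grow 1F t rewrite t refl = refl

ungrow : ∀ g → ∃[ g′ ] g ≡ growth (edge g) ℕ.+ g′ × Trimmed (edge g) g′
ungrow zero    = zero , refl , λ _ → refl
ungrow (suc g) = g , refl , λ ()

edge≡1⇒zero : ∀ {g} → edge g ≡ 1F → g ≡ 0
edge≡1⇒zero {zero} _ = refl

≤1⇒growth : ∀ {g} → g ≤ 1 → g ≡ growth (edge g)
≤1⇒growth z≤n       = refl
≤1⇒growth (s≤s z≤n) = refl

balanced⇒parts : ∀ g xs z → Balanced (enc g (xs ∷ʳ z)) → BalancedParts g xs z
balanced⇒parts g xs z = balancedGaps⇒parts g xs z ∘ balanced⇒balancedGaps g (xs ∷ʳ z)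

parts⇒balanced : ∀ g xs z → BalancedParts g xs z → Balanced (enc g (xs ∷ʳ z))
parts⇒balanced g xs z = balancedGaps⇒balanced g (xs ∷ʳ z) ∘ parts⇒balancedGaps g xs z

enc-∷ʳ-length : ∀ g xs z → length (enc g (xs ∷ʳ z)) ≡ g ℕ.+ (z ℕ.+ sum xs) ℕ.+ suc (length xs)
enc-∷ʳ-length g xs z = trans (enc-length g (xs ∷ʳ z))
  (cong₂ (λ m n → g ℕ.+ m ℕ.+ n) (sum-∷ʳ xs z) (length-∷ʳ xs z))

enc-∷ʳ-height : ∀ g xs z → height (enc g (xs ∷ʳ z)) ≡ suc (length xs)
enc-∷ʳ-height g xs z = trans (enc-height g (xs ∷ʳ z)) (length-∷ʳ xs z)

height-suc⇒enc : ∀ {k} w → height w ≡ suc k → ∃[ g ] ∃₂ λ xs z → w ≡ enc g (xs ∷ʳ z) × length xs ≡ k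
height-suc⇒enc w ht with enc-surjective w
... | g , ys , refl with initLast ys
... | []       = contradiction (trans (sym (enc-height g [])) ht) λ ()
... | xs ∷ʳ′ z = g , xs , z , refl , ℕ.suc-injective (trans (sym (enc-∷ʳ-height g xs z)) ht)

-- The growth bijection

private
  -- First gap, inner gaps and last gap of a word containing a 1. These triples index the words
  -- before and after growth simultaneously.
  Gaps : Set
  Gaps = ℕ × List ℕ × ℕ

  plain : Gaps → Word
  plain (g , xs , z) = enc g (xs ∷ʳ z)

  grown : Fin 2 → Fin 2 → Gaps → Word
  grown a b (g , xs , z) = enc (growth a ℕ.+ g) (map suc xs ∷ʳ (growth b ℕ.+ z))

  plain-injective : ∀ {s t} → plain s ≡ plain t → s ≡ t
  plain-injective {g , xs , z} {h , ys , y} eq with enc-injective g (xs ∷ʳ z) h (ys ∷ʳ y) eq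
  ... | refl , eq′ with ∷ʳ-injective xs ys eq′
  ... | refl , refl = refl

  grown-injective : ∀ a b {s t} → grown a b s ≡ grown a b t → s ≡ t
  grown-injective a b {g , xs , z} {h , ys , y} eq
    with enc-injective (growth a ℕ.+ g) (map suc xs ∷ʳ _) (growth a ℕ.+ h) (map suc ys ∷ʳ _) eq
  ... | eq₁ , eq′ with ℕ.+-cancelˡ-≡ (growth a) g h eq₁ | ∷ʳ-injective (map suc xs) (map suc ys) eq′
  ... | refl | eq₂ , eq₃ with map-injective ℕ.suc-injective eq₂ | ℕ.+-cancelˡ-≡ (growth b) z y eq₃
  ... | refl | refl = refl

  length-grown : ∀ a b g xs z →
    length (grown a b (g , xs , z)) ≡
    length (plain (g , xs , z)) ℕ.+ (length xs ℕ.+ (growth a ℕ.+ growth b))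
  length-grown a b g xs z = trans (enc-∷ʳ-length (growth a ℕ.+ g) (map suc xs) (growth b ℕ.+ z))
    (trans (cong₂ (λ m n → growth a ℕ.+ g ℕ.+ (growth b ℕ.+ z ℕ.+ m) ℕ.+ suc n)
                  (sum-map-suc xs) (length-map suc xs))
      (trans (rearrange (growth a) (growth b) g z (sum xs) (length xs))
        (cong (ℕ._+ (length xs ℕ.+ (growth a ℕ.+ growth b))) (sym (enc-∷ʳ-length g xs z)))))
    where
    rearrange : ∀ a b g z s k → a ℕ.+ g ℕ.+ (b ℕ.+ z ℕ.+ (k ℕ.+ s)) ℕ.+ suc k ≡
                                g ℕ.+ (z ℕ.+ s) ℕ.+ suc k ℕ.+ (k ℕ.+ (a ℕ.+ b))
    rearrange = ℕ-Solver.solve-∀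

-- The hypothesis excludes words such as 0110, whose inner gap 0 is not the result of growth.
module _ (a b : Fin 2) {L k : ℕ} (k<L : k < L) where
  private
    -- A word of height k + 1 has k inner gaps, each gaining one 0; the two ends gain `growth a` and
    -- `growth b`.
    L⁺ = L ℕ.+ (k ℕ.+ (growth a ℕ.+ growth b))
    shorter = filter (trims? a b) (𝕊 L (suc k))
    longer = filter (hasEnds? a b) (𝕊 L⁺ (suc k))

    plain⇒grown : ∀ {w} → w ∈ shorter → ∃[ t ] w ≡ plain t × grown a b t ∈ longer
    plain⇒grown {w} w∈ with ∈-filter⁻ (trims? a b) {xs = 𝕊 L (suc k)} w∈
    ... | w∈𝕊 , trim-first , trim-last with ∈-𝕊⁻ {L} w∈𝕊
    ... | bal , len , ht with height-suc⇒enc w ht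
    ... | g , xs , z , refl , lenxs =
      (g , xs , z) , refl ,
      ∈-filter⁺ (hasEnds? a b)
        (∈-𝕊⁺ (parts⇒balanced _ (map suc xs) _ (parts-grow⁺ a b t t′ (balanced⇒parts g xs z bal)))
          (trans (length-grown a b g xs z)
            (cong₂ (λ m n → m ℕ.+ (n ℕ.+ (growth a ℕ.+ growth b))) len lenxs))
          (trans (enc-∷ʳ-height (growth a ℕ.+ g) (map suc xs) (growth b ℕ.+ z))
            (cong suc (trans (length-map suc xs) lenxs))))
        (trans (first-enc _ (map suc xs) _) (edge-grow a t) ,
         trans (last-enc (growth a ℕ.+ g) (map suc xs) _) (edge-grow b t′))
      where
      t : Trimmed a g
      t eq = edge≡1⇒zero (trans (sym (first-enc g xs z)) (trim-first eq))
      t′ : Trimmed b z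
      t′ eq = edge≡1⇒zero (trans (sym (last-enc g xs z)) (trim-last eq))

    grown⇒plain : ∀ {w} → w ∈ longer → ∃[ t ] w ≡ grown a b t × plain t ∈ shorter
    grown⇒plain {w} w∈ with ∈-filter⁻ (hasEnds? a b) {xs = 𝕊 L⁺ (suc k)} w∈
    ... | w∈𝕊 , first≡a , last≡b with ∈-𝕊⁻ {L⁺} w∈𝕊
    ... | bal , len , ht with height-suc⇒enc w ht
    ... | g , ys , z , refl , refl
      with trans (sym (first-enc g ys z)) first≡a | trans (sym (last-enc g ys z)) last≡b
    ... | refl | refl with shrink? ys
    -- With an inner gap 0 both outer gaps are at most 1, hence equal to the growth at their ends,
    -- and the inner gaps sum to less than k. Cancelling `c` from the length leaves L ≤ k.
    ... | inj₂ 0∈ = contradiction k<L (ℕ.≤⇒≯ (ℕ.+-cancelʳ-≤ c _ _ (begin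
      L ℕ.+ c                                            ≡⟨ len ⟨
      length (enc g (ys ∷ʳ z))                           ≡⟨ enc-∷ʳ-length g ys z ⟩
      g ℕ.+ (z ℕ.+ sum ys) ℕ.+ suc k
        ≡⟨ cong₂ (λ m n → m ℕ.+ (n ℕ.+ sum ys) ℕ.+ suc k) (≤1⇒growth g≤1) (≤1⇒growth z≤1) ⟩
      growth (edge g) ℕ.+ (growth (edge z) ℕ.+ sum ys) ℕ.+ suc k
        ≡⟨ rearrange (growth (edge g)) (growth (edge z)) (sum ys) k ⟩
      suc (sum ys) ℕ.+ c                                 ≤⟨ ℕ.+-monoˡ-≤ c sum<k ⟩
      k ℕ.+ c                                            ∎)))
      where
      open ℕ.≤-Reasoning
      c = k ℕ.+ (growth (edge g) ℕ.+ growth (edge z))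
      scarce = inner-zero⇒scarce (balanced⇒parts g ys z bal) 0∈
      g≤1 = proj₁ scarce
      z≤1 = proj₁ (proj₂ scarce)
      sum<k = proj₂ (proj₂ scarce)
      rearrange : ∀ a b s k → a ℕ.+ (b ℕ.+ s) ℕ.+ suc k ≡ suc s ℕ.+ (k ℕ.+ (a ℕ.+ b))
      rearrange = ℕ-Solver.solve-∀
    ... | inj₁ (xs , refl) with ungrow g | ungrow z
    ... | g′ , eg , t | z′ , ez , t′ =
      (g′ , xs , z′) , cong₂ (λ m n → enc m (map suc xs ∷ʳ n)) eg ez ,
      ∈-filter⁺ (trims? (edge g) (edge z))
        (∈-𝕊⁺ {L} (parts⇒balanced g′ xs z′ (parts-grow⁻ (edge g) (edge z) t t′
                 (subst₂ (λ m n → BalancedParts m (map suc xs) n) eg ez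
                   (balanced⇒parts g (map suc xs) z bal))))
          (ℕ.+-cancelʳ-≡ (length (map suc xs) ℕ.+ outer) _ _
            (trans (cong (λ m → length (plain (g′ , xs , z′)) ℕ.+ (m ℕ.+ outer)) (length-map suc xs))
              (trans (sym (length-grown (edge g) (edge z) g′ xs z′))
                (trans (sym (cong₂ (λ m n → length (enc m (map suc xs ∷ʳ n))) eg ez)) len))))
          (trans (enc-∷ʳ-height g′ xs z′) (cong suc (sym (length-map suc xs)))))
        ((λ eq → trans (first-enc g′ xs z′) (cong edge (t eq))) ,
         (λ eq → trans (last-enc g′ xs z′) (cong edge (t′ eq))))
      where outer = growth (edge g) ℕ.+ growth (edge z)

  #ends-grow : #ends a b (𝕊 L⁺ (suc k)) ≡ #trims a b (𝕊 L (suc k))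
  #ends-grow = ℕ.≤-antisym
    (length-≤-via (grown a b) plain plain-injective
      (Unique.filter⁺ (hasEnds? a b) (𝕊-unique L⁺ (suc k))) grown⇒plain)
    (length-≤-via plain (grown a b) (grown-injective a b)
      (Unique.filter⁺ (trims? a b) (𝕊-unique L (suc k))) plain⇒grown)

-- Complement symmetry

complement : Word → Word
complement = map opposite

complement-involutive : ∀ w → complement (complement w) ≡ w
complement-involutive []       = refl
complement-involutive (0F ∷ w) = cong (0F ∷_) (complement-involutive w)
complement-involutive (1F ∷ w) = cong (1F ∷_) (complement-involutive w)

complement-injective : ∀ {v w} → complement v ≡ complement w → v ≡ w
complement-injective eq = trans (sym (complement-involutive _))
  (trans (cong complement eq) (complement-involutive _))

complement-zeros : ∀ w → ∣ complement w ∣[ 0F ] ≡ height w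
complement-zeros []       = refl
complement-zeros (0F ∷ w) = complement-zeros w
complement-zeros (1F ∷ w) = cong suc (complement-zeros w)

complement-height : ∀ w → height (complement w) ≡ ∣ w ∣[ 0F ]
complement-height []       = refl
complement-height (0F ∷ w) = cong suc (complement-height w)
complement-height (1F ∷ w) = complement-height w

first-complement : ∀ {n} w → length w ≡ suc n → first (complement w) ≡ opposite (first w)
first-complement (x ∷ w) _ = refl

last-complement : ∀ {n} w → length w ≡ suc n → last (complement w) ≡ opposite (last w)
last-complement (x ∷ w) _ = go x w
  where
  go : ∀ x w → foldl (λ _ y → y) (opposite x) (complement w) ≡ opposite (foldl (λ _ y → y) x w)
  go x []      = refl
  go x (y ∷ w) = go y w

-- Words of equal length differ by as much in their ones as in their zeros.
balanced-complement : ∀ {w} → Balanced w → Balanced (complement w)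
balanced-complement {w} bal u v p q eq = subst (_≤ 1) zeros-diff
  (bal (complement u) (complement v) (transport p) (transport q)
    (trans (length-map opposite u) (trans eq (sym (length-map opposite v)))))
  where
  transport : ∀ {t} → Subword t (complement w) → Subword (complement t) w
  transport {t} p = subst (Subword (complement t)) (complement-involutive w)
    (Infix.map⁺ opposite opposite (Infix.map (cong opposite) p))
  open ≡-Reasoning
  zeros-diff : ∣ ∣ complement u ∣[ 0F ] - ∣ complement v ∣[ 0F ] ∣ ≡ ∣ ∣ u ∣[ 0F ] - ∣ v ∣[ 0F ] ∣
  zeros-diff = begin
    ∣ ∣ complement u ∣[ 0F ] - ∣ complement v ∣[ 0F ] ∣
      ≡⟨ cong₂ ∣_-_∣ (complement-zeros u) (complement-zeros v) ⟩
    ∣ height u - height v ∣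
      ≡⟨ ℕ.∣m+n-m+o∣≡∣n-o∣ ∣ u ∣[ 0F ] (height u) (height v) ⟨
    ∣ ∣ u ∣[ 0F ] ℕ.+ height u - ∣ u ∣[ 0F ] ℕ.+ height v ∣
      ≡⟨ cong (λ n → ∣ n - ∣ u ∣[ 0F ] ℕ.+ height v ∣)
           (trans (sym (length≡zeros+height u)) (trans eq (length≡zeros+height v))) ⟩
    ∣ ∣ v ∣[ 0F ] ℕ.+ height v - ∣ u ∣[ 0F ] ℕ.+ height v ∣
      ≡⟨ cong₂ ∣_-_∣ (ℕ.+-comm ∣ v ∣[ 0F ] _) (ℕ.+-comm ∣ u ∣[ 0F ] _) ⟩
    ∣ height v ℕ.+ ∣ v ∣[ 0F ] - height v ℕ.+ ∣ u ∣[ 0F ] ∣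
      ≡⟨ ℕ.∣m+n-m+o∣≡∣n-o∣ (height v) ∣ v ∣[ 0F ] ∣ u ∣[ 0F ] ⟩
    ∣ ∣ v ∣[ 0F ] - ∣ u ∣[ 0F ] ∣
      ≡⟨ ℕ.∣-∣-comm ∣ v ∣[ 0F ] ∣ u ∣[ 0F ] ⟩
    ∣ ∣ u ∣[ 0F ] - ∣ v ∣[ 0F ] ∣ ∎

#ends-complement-≤ : ∀ a b {n h h′} → h ℕ.+ h′ ≡ suc n →
  #ends a b (𝕊 (suc n) h) ≤ #ends (opposite a) (opposite b) (𝕊 (suc n) h′)
#ends-complement-≤ a b {n} {h} {h′} h+h′ = length-≤-via id complement complement-injective
  (Unique.filter⁺ (hasEnds? a b) (𝕊-unique (suc n) h)) cover
  where
  cover : ∀ {w} → w ∈ filter (hasEnds? a b) (𝕊 (suc n) h) → ∃[ t ] w ≡ t ×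
    complement t ∈ filter (hasEnds? (opposite a) (opposite b)) (𝕊 (suc n) h′)
  cover {w} w∈ with ∈-filter⁻ (hasEnds? a b) {xs = 𝕊 (suc n) h} w∈
  ... | w∈𝕊 , refl , refl with ∈-𝕊⁻ {suc n} w∈𝕊
  ... | bal , len , refl = w , refl , ∈-filter⁺ (hasEnds? (opposite a) (opposite b))
    (∈-𝕊⁺ (balanced-complement bal) (trans (length-map opposite w) len)
      (trans (complement-height w) (ℕ.+-cancelʳ-≡ (height w) _ _
        (trans (sym (length≡zeros+height w))
          (trans len (trans (sym h+h′) (ℕ.+-comm (height w) h′)))))))
    (first-complement w len , last-complement w len)

#ends-complement : ∀ a b {n h h′} → h ℕ.+ h′ ≡ suc n →
  #ends a b (𝕊 (suc n) h) ≡ #ends (opposite a) (opposite b) (𝕊 (suc n) h′)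
#ends-complement a b {n} {h} {h′} eq = ℕ.≤-antisym (#ends-complement-≤ a b eq)
  (subst₂ (λ c d → #ends (opposite a) (opposite b) (𝕊 (suc n) h′) ≤ #ends c d (𝕊 (suc n) h))
    (Fin.opposite-involutive a) (Fin.opposite-involutive b)
    (#ends-complement-≤ (opposite a) (opposite b) (trans (ℕ.+-comm h′ h) eq)))

-- Words of height 0 and 1

length≡0 : ∀ {A : Set} {xs : List A} → (∀ {x} → x ∉ xs) → length xs ≡ 0
length≡0 {xs = []}    ∉ = refl
length≡0 {xs = x ∷ _} ∉ = contradiction (here refl) ∉

length≡1 : ∀ {A : Set} {xs : List A} {w} → Unique xs → w ∈ xs →
  (∀ {x} → x ∈ xs → x ≡ w) → length xs ≡ 1
length≡1 {xs = _ ∷ []}    _ _ _ = refl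
length≡1 {xs = _ ∷ _ ∷ _} ((x≢y All.∷ _) AllPairs.∷ _) _ only =
  contradiction (trans (only (here refl)) (sym (only (there (here refl))))) x≢y

zeros∈𝕊 : ∀ n → enc n [] ∈ 𝕊 n 0
zeros∈𝕊 n = ∈-𝕊⁺ (balancedGaps⇒balanced n [] no-inner)
  (trans (enc-length n []) (trans (ℕ.+-identityʳ _) (ℕ.+-identityʳ n))) (enc-height n [])
  where
  no-inner : BalancedGaps n []
  no-inner us []      y p (here ()) eq
  no-inner us (_ ∷ _) y p (here ()) eq

𝕊-height-0 : ∀ n {w} → w ∈ 𝕊 n 0 → w ≡ enc n []
𝕊-height-0 n {w} w∈ with ∈-𝕊⁻ {n} w∈ | enc-surjective w
... | _ , len , ht | g , x ∷ xs , refl = contradiction (trans (sym (enc-height g (x ∷ xs))) ht) λ ()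
... | _ , len , ht | g , [] , refl = cong (λ m → enc m [])
  (trans (sym (trans (enc-length g []) (trans (ℕ.+-identityʳ _) (ℕ.+-identityʳ g)))) len)

length-𝕊-0 : ∀ n → length (𝕊 n 0) ≡ 1
length-𝕊-0 n = length≡1 (𝕊-unique n 0) (zeros∈𝕊 n) (𝕊-height-0 n)

last-zeros : ∀ n → last (enc n []) ≡ 0F
last-zeros zero    = refl
last-zeros (suc n) = last-zeros n

#ends-00-height-0 : ∀ n → #ends 0F 0F (𝕊 (suc n) 0) ≡ 1
#ends-00-height-0 n = length≡1 (Unique.filter⁺ (hasEnds? 0F 0F) (𝕊-unique (suc n) 0))
  (∈-filter⁺ (hasEnds? 0F 0F) (zeros∈𝕊 (suc n)) (refl , last-zeros n))
  (λ w∈ → 𝕊-height-0 (suc n) (proj₁ (∈-filter⁻ (hasEnds? 0F 0F) {xs = 𝕊 (suc n) 0} w∈)))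

#ends-11-height-0 : ∀ n → #ends 1F 1F (𝕊 n 0) ≡ 0
#ends-11-height-0 n = length≡0 none
  where
  none : ∀ {w} → w ∉ filter (hasEnds? 1F 1F) (𝕊 n 0)
  none w∈ with ∈-filter⁻ (hasEnds? 1F 1F) {xs = 𝕊 n 0} w∈
  ... | w∈𝕊 , _ , last≡1 rewrite 𝕊-height-0 n w∈𝕊 =
    contradiction (trans (sym last≡1) (last-zeros n)) λ ()

-- If the only 1 is both the first and the last letter, both gaps vanish and the word has length 1.
#ends-11-height-1 : ∀ n → #ends 1F 1F (𝕊 (suc (suc n)) 1) ≡ 0
#ends-11-height-1 n = length≡0 none
  where
  none : ∀ {w} → w ∉ filter (hasEnds? 1F 1F) (𝕊 (suc (suc n)) 1)
  none {w} w∈ with ∈-filter⁻ (hasEnds? 1F 1F) {xs = 𝕊 (suc (suc n)) 1} w∈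
  ... | w∈𝕊 , first≡1 , last≡1 with ∈-𝕊⁻ {suc (suc n)} w∈𝕊
  ... | _ , len , ht with height-suc⇒enc w ht
  ... | g , [] , z , refl , _
    with edge≡1⇒zero {g} (trans (sym (first-enc g [] z)) first≡1)
       | edge≡1⇒zero {z} (trans (sym (last-enc g [] z)) last≡1)
  none w∈ | _ | _ , () , _ | _ | refl | refl

-- The function `s` and the counts with two equal ends

length-𝕊-complement : ∀ {n h h′} → h ℕ.+ h′ ≡ suc n → length (𝕊 (suc n) h) ≡ length (𝕊 (suc n) h′)
length-𝕊-complement {n} {h} {h′} eq = begin
  length V
    ≡⟨ #ends-total V ⟩
  #ends 0F 0F V ℕ.+ #ends 0F 1F V ℕ.+ (#ends 1F 0F V ℕ.+ #ends 1F 1F V)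
    ≡⟨ cong₂ ℕ._+_ (cong₂ ℕ._+_ (#ends-complement 0F 0F eq) (#ends-complement 0F 1F eq))
                   (cong₂ ℕ._+_ (#ends-complement 1F 0F eq) (#ends-complement 1F 1F eq)) ⟩
  #ends 1F 1F W ℕ.+ #ends 1F 0F W ℕ.+ (#ends 0F 1F W ℕ.+ #ends 0F 0F W)
    ≡⟨ reverse (#ends 1F 1F W) (#ends 1F 0F W) (#ends 0F 1F W) (#ends 0F 0F W) ⟩
  #ends 0F 0F W ℕ.+ #ends 0F 1F W ℕ.+ (#ends 1F 0F W ℕ.+ #ends 1F 1F W)
    ≡⟨ #ends-total W ⟨
  length W ∎
  where
  open ≡-Reasoning
  V = 𝕊 (suc n) h
  W = 𝕊 (suc n) h′
  reverse : ∀ a b c d → a ℕ.+ b ℕ.+ (c ℕ.+ d) ≡ d ℕ.+ c ℕ.+ (b ℕ.+ a)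
  reverse = ℕ-Solver.solve-∀

-- For L > 0 the reduction modulo L changes only h = L, which becomes 0; complementation exchanges
-- these two heights.
s≡length-𝕊 : ∀ L h → h ≤ L → s (+ L) (+ h) ≡ length (𝕊 L h)
s≡length-𝕊 zero    zero z≤n = sym (length-𝕊-0 0)
s≡length-𝕊 (suc n) h h≤L with ℕ.m≤n⇒m<n∨m≡n h≤L
... | inj₁ h<L  = cong (λ i → length (𝕊 (suc n) i)) (m<n⇒m%n≡m h<L)
... | inj₂ refl = trans (cong (λ i → length (𝕊 (suc n) i)) (n%n≡0 (suc n)))
  (length-𝕊-complement {n} {0} refl)

s-periodic : ∀ L h → s (+ L) (+ (L ℕ.+ h)) ≡ s (+ L) (+ h)
s-periodic zero    h = refl
s-periodic (suc n) h = cong (λ i → length (𝕊 (suc n) i))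
  (trans (cong (_% suc n) (ℕ.+-comm (suc n) h)) ([m+n]%n≡m%n h (suc n)))

-- Write m = k + d. If d ≤ k, complementing and undoing one growth step leads to all balanced words
-- of length k and height d. If d > k, undoing one growth step with both ends 1 replaces m by d,
-- which is congruent to m modulo k.
#ends-11 : ∀ m k → k ≤ m → #ends 1F 1F (𝕊 (suc m) (suc k)) ≡ s (+ k) (+ m)
#ends-11 = <-rec _ step
  where
  step : ∀ m → (∀ {i} → i < m → ∀ k → k ≤ i → #ends 1F 1F (𝕊 (suc i) (suc k)) ≡ s (+ k) (+ i)) →
         ∀ k → k ≤ m → #ends 1F 1F (𝕊 (suc m) (suc k)) ≡ s (+ k) (+ m)
  step m rec k k≤m with ℕ.m≤n⇒∃[o]m+o≡n k≤m
  ... | d , refl with d ℕ.≤? k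
  -- The complement has height 0, where `#ends-grow` does not apply, so it is counted directly. For
  -- k = 0 the value s(0,0) = 1 accounts for the word 1.
  step m rec k k≤m | zero , refl | yes d≤k = begin
    #ends 1F 1F (𝕊 (suc m) (suc k))    ≡⟨ #ends-complement 1F 1F (refl {x = suc m}) ⟩
    #ends 0F 0F (𝕊 (suc m) 0)          ≡⟨ #ends-00-height-0 m ⟩
    1                                  ≡⟨ length-𝕊-0 k ⟨
    length (𝕊 k 0)                     ≡⟨ s≡length-𝕊 k 0 z≤n ⟨
    s (+ k) (+ 0)                      ≡⟨ s-periodic k 0 ⟨
    s (+ k) (+ m)                      ∎
    where open ≡-Reasoning
  step m rec k k≤m | suc j , refl | yes d≤k = begin
    #ends 1F 1F (𝕊 (suc m) (suc k))    ≡⟨ #ends-complement 1F 1F (refl {x = suc m}) ⟩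
    #ends 0F 0F (𝕊 (suc m) (suc j))    ≡⟨ cong (λ L → #ends 0F 0F (𝕊 L (suc j))) (rearrange k j) ⟩
    #ends 0F 0F (𝕊 (k ℕ.+ (j ℕ.+ 2)) (suc j))  ≡⟨ #ends-grow 0F 0F d≤k ⟩
    #trims 0F 0F (𝕊 k (suc j))         ≡⟨ #trims-00 (𝕊 k (suc j)) ⟩
    length (𝕊 k (suc j))               ≡⟨ s≡length-𝕊 k (suc j) d≤k ⟨
    s (+ k) (+ suc j)                  ≡⟨ s-periodic k (suc j) ⟨
    s (+ k) (+ m)                      ∎
    where
    open ≡-Reasoning
    rearrange : ∀ k j → suc (k ℕ.+ suc j) ≡ k ℕ.+ (j ℕ.+ 2)
    rearrange = ℕ-Solver.solve-∀
  step m rec zero k≤m | zero , refl | no d≰k = contradiction z≤n d≰k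
  -- The count 0 agrees with the convention s(0,h) = 0 for h nonzero.
  step m rec zero k≤m | suc d , refl | no d≰k = #ends-11-height-1 d
  -- Since k is positive, d < m and the induction hypothesis is available at d.
  step m rec k@(suc _) k≤m | d , refl | no d≰k = begin
    #ends 1F 1F (𝕊 (suc m) (suc k))    ≡⟨ cong (λ L → #ends 1F 1F (𝕊 L (suc k))) (rearrange k d) ⟩
    #ends 1F 1F (𝕊 (suc d ℕ.+ (k ℕ.+ 0)) (suc k))  ≡⟨ #ends-grow 1F 1F (s≤s k≤d) ⟩
    #trims 1F 1F (𝕊 (suc d) (suc k))   ≡⟨ #trims-11 (𝕊 (suc d) (suc k)) ⟩
    #ends 1F 1F (𝕊 (suc d) (suc k))    ≡⟨ rec (ℕ.m<n+m d (s≤s z≤n)) k k≤d ⟩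
    s (+ k) (+ d)                      ≡⟨ s-periodic k d ⟨
    s (+ k) (+ m)                      ∎
    where
    open ≡-Reasoning
    k≤d = ℕ.<⇒≤ (ℕ.≰⇒> d≰k)
    rearrange : ∀ k d → suc (k ℕ.+ d) ≡ suc d ℕ.+ (k ℕ.+ 0)
    rearrange = ℕ-Solver.solve-∀

-- Here d is the number of zeros, which is the height of the complement. For d = 0 there is no such
-- word, in accordance with the value 0 of `s` at first argument -1.
#ends-00 : ∀ h d {n} → h ℕ.+ d ≡ suc n → #ends 0F 0F (𝕊 (suc n) h) ≡ s (+ d - + 1) (+ h)
#ends-00 h zero    {n} eq = trans (#ends-complement 0F 0F eq) (#ends-11-height-0 (suc n))
#ends-00 h (suc k) {n} eq with trans (sym (ℕ.+-suc h k)) eq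
... | refl = begin
  #ends 0F 0F (𝕊 (suc n) h)         ≡⟨ #ends-complement 0F 0F eq ⟩
  #ends 1F 1F (𝕊 (suc n) (suc k))   ≡⟨ #ends-11 n k (ℕ.m≤n+m k h) ⟩
  s (+ k) (+ n)                     ≡⟨ cong (λ i → s (+ k) (+ i)) (ℕ.+-comm h k) ⟩
  s (+ k) (+ (k ℕ.+ h))             ≡⟨ s-periodic k h ⟩
  s (+ k) (+ h)                     ∎
  where open ≡-Reasoning

-- The recurrence

-- In this parametrization M = L - h and d = L - 2h. The four end counts at L are a, x + e, y + e
-- and f, those at M are b, x, y and e; eliminating x + y between the two totals gives the identity.
recurrence : ∀ k d → let h = suc k ; M = h ℕ.+ d ; L = h ℕ.+ M in
  + s (+ L) (+ h) ≡
    + s (+ (k ℕ.+ d)) (+ h) + + s (+ M) (+ h) - + s (+ d - + 1) (+ h)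
      + + s (+ k) (+ (k ℕ.+ d)) + + s (+ k) (+ M)
recurrence k d = begin
  + s (+ L) (+ h)
    ≡⟨ cong +_ (trans (s≡length-𝕊 L h (ℕ.m≤m+n h M)) (#ends-total (𝕊 L h))) ⟩
  + (#ends 0F 0F (𝕊 L h) ℕ.+ #ends 0F 1F (𝕊 L h) ℕ.+ (#ends 1F 0F (𝕊 L h) ℕ.+ #ends 1F 1F (𝕊 L h)))
    ≡⟨ cong +_ (cong₂ ℕ._+_ (cong₂ ℕ._+_ ends-00 ends-01) (cong₂ ℕ._+_ ends-10 ends-11)) ⟩
  + (a ℕ.+ (x ℕ.+ e) ℕ.+ (y ℕ.+ e ℕ.+ f))
    ≡⟨ rearrange (+ a) (+ b) (+ x) (+ y) (+ e) (+ f) ⟩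
  + a + + (b ℕ.+ x ℕ.+ (y ℕ.+ e)) - + b + + e + + f
    ≡⟨ cong (λ i → + a + + i - + b + + e + + f) total ⟨
  + a + + s (+ M) (+ h) - + b + + e + + f ∎
  where
  open ≡-Reasoning
  h = suc k
  M = h ℕ.+ d
  L = h ℕ.+ M
  a = s (+ (k ℕ.+ d)) (+ h)
  b = s (+ d - + 1) (+ h)
  e = s (+ k) (+ (k ℕ.+ d))
  f = s (+ k) (+ M)
  x = #ends 0F 1F (𝕊 M h)
  y = #ends 1F 0F (𝕊 M h)
  k<M : k < M
  k<M = s≤s (ℕ.m≤m+n k d)
  L≡M+h : L ≡ M ℕ.+ (k ℕ.+ 1)
  L≡M+h = trans (ℕ.+-comm h M) (cong (M ℕ.+_) (ℕ.+-comm 1 k))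
  -- With both ends 1 only the k = h - 1 inner gaps grow, so the shorter words have length M + 1
  -- instead of M.
  L≡1+M+k : L ≡ suc M ℕ.+ (k ℕ.+ 0)
  L≡1+M+k = trans (cong suc (ℕ.+-comm k M)) (cong (λ i → suc (M ℕ.+ i)) (sym (ℕ.+-identityʳ k)))
  middle : #ends 1F 1F (𝕊 M h) ≡ e
  middle = #ends-11 (k ℕ.+ d) k (ℕ.m≤m+n k d)
  ends-00 : #ends 0F 0F (𝕊 L h) ≡ a
  ends-00 = #ends-00 h M refl
  ends-01 : #ends 0F 1F (𝕊 L h) ≡ x ℕ.+ e
  ends-01 = trans (cong (λ i → #ends 0F 1F (𝕊 i h)) L≡M+h)
    (trans (#ends-grow 0F 1F k<M) (trans (#trims-01 (𝕊 M h)) (cong (x ℕ.+_) middle)))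
  ends-10 : #ends 1F 0F (𝕊 L h) ≡ y ℕ.+ e
  ends-10 = trans (cong (λ i → #ends 1F 0F (𝕊 i h)) L≡M+h)
    (trans (#ends-grow 1F 0F k<M) (trans (#trims-10 (𝕊 M h)) (cong (y ℕ.+_) middle)))
  ends-11 : #ends 1F 1F (𝕊 L h) ≡ f
  ends-11 = trans (cong (λ i → #ends 1F 1F (𝕊 i h)) L≡1+M+k)
    (trans (#ends-grow 1F 1F (ℕ.m≤n⇒m≤1+n k<M))
      (trans (#trims-11 (𝕊 (suc M) h)) (#ends-11 M k (ℕ.<⇒≤ k<M))))
  total : s (+ M) (+ h) ≡ b ℕ.+ x ℕ.+ (y ℕ.+ e)
  total = trans (s≡length-𝕊 M h (ℕ.m≤m+n h d)) (trans (#ends-total (𝕊 M h))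
    (cong₂ (λ i j → i ℕ.+ x ℕ.+ (y ℕ.+ j)) (#ends-00 h d refl) middle))
  rearrange : ∀ a b x y e f → a + (x + e) + (y + e + f) ≡ a + (b + x + (y + e)) - b + e + f
  rearrange = ℤ-Solver.solve-∀

-- Passage to integer arguments

2*m≤n⇒∃[o]m+[m+o]≡n : ∀ m {n} → 2 ℕ.* m ≤ n → ∃[ o ] m ℕ.+ (m ℕ.+ o) ≡ n
2*m≤n⇒∃[o]m+[m+o]≡n m 2m≤n with ℕ.m≤n⇒∃[o]m+o≡n 2m≤n
... | o , eq = o , trans (rearrange m o) eq
  where
  rearrange : ∀ m o → m ℕ.+ (m ℕ.+ o) ≡ 2 ℕ.* m ℕ.+ o
  rearrange = ℕ-Solver.solve-∀

theorem1 : ∀ (L h : ℕ) → 2 ℕ.* h ≤ L →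
    + s (+ L) (+ h) ≡
    + s (+ L - + h - + 1) (+ h) + + s (+ L - + h) (+ h)
    - + s (+ L - + 2 * + h - + 1) (+ h)
    + + s (+ h - + 1) (+ L - + 2) + + s (+ h - + 1) (+ L - + 1)
-- For h = 0 the first and third terms cancel, and the last two vanish because their first argument
-- is -1.
theorem1 L zero _ = sym (begin
  + p + + q - + p + + 0 + + 0      ≡⟨ cancel (+ p) (+ q) ⟩
  + q                              ≡⟨ cong (λ i → + s (+ i) (+ 0)) (ℕ.+-identityʳ L) ⟩
  + s (+ L) (+ 0)                  ∎)
  where
  open ≡-Reasoning
  p = s (+ L - + 0 - + 1) (+ 0)
  q = s (+ L - + 0) (+ 0)
  cancel : ∀ p q → p + q - p + + 0 + + 0 ≡ q
  cancel = ℤ-Solver.solve-∀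
theorem1 L (suc k) 2h≤L with 2*m≤n⇒∃[o]m+[m+o]≡n (suc k) 2h≤L
... | d , refl = trans (recurrence k d)
  (cong₂ _+_ (cong₂ _+_ (cong₂ _-_ (cong₂ _+_
    (at-h (L-h-1 (+ k) (+ d))) (at-h (L-h (+ k) (+ d)))) (at-h (L-2h-1 (+ k) (+ d))))
    (at-k (k ℕ.+ d) (L-2 (+ k) (+ d)))) (at-k (suc k ℕ.+ d) (L-1 (+ k) (+ d))))
  where
  at-h : ∀ {i j} → i ≡ j → + s i (+ suc k) ≡ + s j (+ suc k)
  at-h = cong (λ i → + s i (+ suc k))
  -- The arguments L - 2 and L - 1 exceed those in `recurrence` by k = h - 1, a period of `s (+ k)`.
  at-k : ∀ m {i} → + (k ℕ.+ m) ≡ i → + s (+ k) (+ m) ≡ + s (+ k) i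
  at-k m eq = cong +_ (trans (sym (s-periodic k m)) (cong (s (+ k)) eq))
  L-h-1 : ∀ k d → k + d ≡ + 1 + k + (+ 1 + k + d) - (+ 1 + k) - + 1
  L-h-1 = ℤ-Solver.solve-∀
  L-h : ∀ k d → + 1 + k + d ≡ + 1 + k + (+ 1 + k + d) - (+ 1 + k)
  L-h = ℤ-Solver.solve-∀
  L-2h-1 : ∀ k d → d - + 1 ≡ + 1 + k + (+ 1 + k + d) - + 2 * (+ 1 + k) - + 1
  L-2h-1 = ℤ-Solver.solve-∀
  L-2 : ∀ k d → k + (k + d) ≡ + 1 + k + (+ 1 + k + d) - + 2
  L-2 = ℤ-Solver.solve-∀
  L-1 : ∀ k d → k + (+ 1 + k + d) ≡ + 1 + k + (+ 1 + k + d) - + 1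
  L-1 = ℤ-Solver.solve-∀
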